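{- Let $n\ge1$, $b\ge1$. For $0\le i,j\le n$: (1) the transition probabilities of the type $B$ base-$(2b+1)$ carries chain are $$P(i,j)=\frac1{(2b+1)^n}\sum_{l\ge0}(-1)^l\binom{n+1}{l}\binom{n+(j-l)(2b+1)+b-i}{n};$$ (2) its $r$-step transition probabilities ($r\ge1$) are $$P^r(i,j)=\frac1{(2b+1)^{rn}}\sum_{l\ge0}(-1)^l\binom{n+1}{l}\binom{n+(j-l)(2b+1)^r+\frac{(2b+1)^r-1}{2}-i}{n}.$$
   Context: Binomial convention: $\binom{m}{n}=\frac{m(m-1)\cdots(m-n+1)}{n!}$ if $m\ge n$ and $\binom{m}{n}=0$ if $m<n$ (including negative $m$). The type $B$ base-$(2b+1)$ carries chain (for $n$ summands) is the Markov chain $\kappa_0=0,\kappa_1,\dots$ on $\{0,1,\dots,n\}$ obtained by adding $n$ random base-$(2b+1)$ numbers with i.i.d. digits uniform on $\{0,1,\dots,2b\}$ together with the number all of whose digits equal $b$: $\kappa_{t+1}=\lfloor(\kappa_t+b+X_{t+1,1}+\dots+X_{t+1,n})/(2b+1)\rfloor$ with $X_{t,k}$ i.i.d. uniform on $\{0,\dots,2b\}$. -}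

module Defs where

open import Data.Bool using (if_then_else_)
open import Data.Fin as Fin using (Fin; toℕ; fromℕ<)
open import Data.Fin.Properties using (toℕ≤pred[n])
open import Data.Integer as ℤ using (ℤ; +_; -[1+_])
import Data.Integer.Properties as ℤ
open import Data.List using (List; []; _∷_; allFin; cartesianProductWith; filter; length)
open import Data.Nat using (ℕ; zero; suc; _+_; _*_; _^_; _/_; _≤_; _<_; z≤n; s≤s)
open import Data.Nat.Combinatorics using (_C_)
open import Data.Nat.DivMod using (m<n*o⇒m/o<n)
open import Data.Nat.Properties
  using (+-mono-≤; +-monoˡ-≤; m≤m+n; m^n≢0; module ≤-Reasoning)
open import Data.Nat.Tactic.RingSolver using (solve-∀)
open import Data.Rational as ℚ using (ℚ; 0ℚ; 1ℚ)
import Data.Rational.Properties as ℚ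
open import Data.Vec as Vec using (Vec; []; _∷_)
open import Relation.Binary.PropositionalEquality using (_≡_)
open import Relation.Nullary using (does)

open import Algebra.Properties.CommutativeMonoid.Sum ℤ.+-0-commutativeMonoid public
  using () renaming (sum to sumℤ)
open import Algebra.Properties.CommutativeMonoid.Sum ℚ.+-0-commutativeMonoid public
  using () renaming (sum to sumℚ)

-- s /[2 b +1]^ k is the rational number s / (2b+1)^k.
infixl 6 _/[2_+1]^_
_/[2_+1]^_ : ℤ → ℕ → ℕ → ℚ
s /[2 b +1]^ k = (s ℚ./ (suc (2 * b) ^ k)) {{m^n≢0 (suc (2 * b)) k}}

-- Binomial coefficient with an integer upper index, zero whenever the upper
-- index is smaller than the lower one; in particular for negative upper index.
binom : ℤ → ℕ → ℕ
binom (+ m)    n = m C n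
binom -[1+ _ ] n = 0

-- Base-(2b+1) digits: the elements of {0, …, 2b}.
Digit : ℕ → Set
Digit b = Fin (suc (2 * b))

digitSum : ∀ {n} b → Vec (Digit b) n → ℕ
digitSum b x = Vec.sum (Vec.map toℕ x)

digitSum≤ : ∀ {n} b (x : Vec (Digit b) n) → digitSum b x ≤ n * (2 * b)
digitSum≤ b []      = z≤n
digitSum≤ b (d ∷ x) = +-mono-≤ (toℕ≤pred[n] d) (digitSum≤ b x)

carry<suc-n : ∀ n b (i : Fin (suc n)) (x : Vec (Digit b) n) →
              (toℕ i + b + digitSum b x) / suc (2 * b) < suc n
carry<suc-n n b i x = m<n*o⇒m/o<n (begin-strict
  toℕ i + b + digitSum b x       ≤⟨ +-mono-≤ (+-monoˡ-≤ b (toℕ≤pred[n] i)) (digitSum≤ b x) ⟩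
  n + b + n * (2 * b)            <⟨ s≤s (m≤m+n _ b) ⟩
  suc (n + b + n * (2 * b) + b)  ≡⟨ lemma n b ⟩
  suc n * suc (2 * b)            ∎)
  where
  open ≤-Reasoning
  lemma : ∀ n b → suc (n + b + n * (2 * b) + b) ≡ suc n * suc (2 * b)
  lemma = solve-∀

-- One step of the chain: from the carry i and the column of digits
-- x = (X₁, …, Xₙ) to the next carry ⌊(i + b + X₁ + … + Xₙ) / (2b+1)⌋.
-- The summand b is the digit of the additional fixed number.
nextCarry : ∀ n b → Fin (suc n) → Vec (Digit b) n → Fin (suc n)
nextCarry n b i x = fromℕ< (carry<suc-n n b i x)

-- The sample space {0, …, 2b}ⁿ of one column, each element listed once.
columns : ∀ b n → List (Vec (Digit b) n)
columns b zero    = [] ∷ []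
columns b (suc n) = cartesianProductWith _∷_ (allFin _) (columns b n)

-- Matrices indexed by the states 0, …, n.
Matrix : ℕ → Set
Matrix n = Fin (suc n) → Fin (suc n) → ℚ

-- P(i,j): the probability that nextCarry i X = j. The digits being i.i.d.
-- uniform, X is uniform on the (2b+1)ⁿ columns.
carriesMatrix : ∀ n b → Matrix n
carriesMatrix n b i j =
  + length (filter (λ x → nextCarry n b i x Fin.≟ j) (columns b n)) /[2 b +1]^ n

-- r-step transition probabilities of the chain with transition matrix M,
-- i.e. the entries of the r-th matrix power.
stepMatrix : ∀ {n} → Matrix n → ℕ → Matrix n
stepMatrix M zero    i j = if does (i Fin.≟ j) then 1ℚ else 0ℚ
stepMatrix M (suc r) i j = sumℚ (λ k → M i k ℚ.* stepMatrix M r k j)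

-- Σ_{l ≥ 0} (-1)^l binom(n+1, l) binom(n + (j - l) B + c - i, n), where the
-- terms with l > n+1 vanish because binom(n+1, l) = 0 there.
alternatingSum : (n B c i j : ℕ) → ℤ
alternatingSum n B c i j = sumℤ {suc (suc n)} (λ l →
  ℤ.-1ℤ ℤ.^ toℕ l
    ℤ.* + (suc n C toℕ l)
    ℤ.* + binom (+ n ℤ.+ (+ j ℤ.- + toℕ l) ℤ.* + B ℤ.+ + c ℤ.- + i) n)

-- Let S_n f (boxSum) be the sum of f(x₁ + … + xₙ) over x ∈ {0, …, B-1}ⁿ. Telescoping one coordinate at a
-- time turns S_n of the n-fold unit difference of f, read at m - s, into the n-fold difference of
-- step B of f at m, which expands into an alternating binomial sum. The n-fold unit difference of
-- m ↦ binom(n+m, n) is the indicator of m ≥ 0, and since B = 2c+1 the event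
-- ⌊(i+c+s)/B⌋ = j is a difference, with step B, of two such indicators at jB + c - i - s. This
-- gives the one-step formula in every odd base. For r steps, each summand's r digits form one
-- base-B^r digit and nested floors collapse, so the r-step chain is the one-step chain in base B^r.

module Submission where

open import Defs
open import Data.Bool using (if_then_else_)
open import Data.Fin as Fin using (Fin; zero; suc; toℕ)
open import Data.Fin.Properties using (toℕ-fromℕ<; toℕ-fromℕ; toℕ-inject₁; toℕ-injective)
open import Data.Integer as ℤ using (ℤ; +_; -[1+_]; 0ℤ; 1ℤ; -1ℤ)
import Data.Integer.Properties as ℤ
open import Data.Integer.Tactic.RingSolver using (solve-∀)
open import Data.List using (List; []; _∷_; _++_; allFin; map; tabulate; filter; length; cartesianProductWith)
open import Data.Nat using (ℕ; zero; suc; _+_; _*_; _∸_; _^_; _/_; _%_; _≥_; NonZero)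
open import Data.Nat.Combinatorics using (_C_; nCk+nC[k+1]≡[n+1]C[k+1]; k>n⇒nCk≡0)
open import Data.Nat.Divisibility using (divides)
open import Data.Nat.DivMod
  using (m≡m%n+[m/n]*n; m%n<n; n/1≡n; m*n/n≡m; m/n/o≡m/[n*o]; +-distrib-/-∣ʳ; /-congˡ)
open import Data.Nat.Properties as ℕ using (m^n≢0; m*n≢0)
open import Data.Nat.Tactic.RingSolver using () renaming (solve-∀ to solve-∀ℕ)
open import Data.Product using (_×_; _,_)
open import Data.Rational as ℚ using (ℚ; 0ℚ; 1ℚ)
import Data.Rational.Properties as ℚ
open import Data.Rational.Unnormalised as ℚᵘ using (mkℚᵘ; *≡*)
import Data.Rational.Unnormalised.Properties as ℚᵘ
open import Data.Vec using (Vec)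
open import Function using (_∘_; id)
open import Level using (0ℓ)
open import Relation.Binary.PropositionalEquality
open import Relation.Nullary using (does; yes; no; contradiction)
open import Relation.Unary using (Pred; Decidable)

open import Algebra.Properties.Semiring.Sum ℤ.+-*-semiring
  using (sum-cong-≗; sum-init-last; ∑-distrib-+; ∑-comm; sum-replicate-zero)

import Algebra.Properties.CommutativeMonoid.Sum ℚ.+-0-commutativeMonoid as ℚ-Sum

open ≡-Reasoning

private
  variable
    A : Set
    n : ℕ

-- Finite sums of integers

∑-distrib-minus : ∀ (f g : Fin n → ℤ) → sumℤ (λ i → f i ℤ.- g i) ≡ sumℤ f ℤ.- sumℤ g
∑-distrib-minus {zero}  f g = refl
∑-distrib-minus {suc n} f g =
  trans (cong (ℤ._+_ (f zero ℤ.- g zero)) (∑-distrib-minus (f ∘ suc) (g ∘ suc)))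
        (regroup (f zero) (g zero) (sumℤ (f ∘ suc)) (sumℤ (g ∘ suc)))
  where
  regroup : ∀ a b c d → (a ℤ.- b) ℤ.+ (c ℤ.- d) ≡ (a ℤ.+ c) ℤ.- (b ℤ.+ d)
  regroup = solve-∀

∑-split : ∀ m k (f : ℕ → ℤ) →
          sumℤ {m + k} (f ∘ toℕ) ≡ sumℤ {m} (f ∘ toℕ) ℤ.+ sumℤ {k} (λ y → f (m + toℕ y))
∑-split zero    k f = sym (ℤ.+-identityˡ _)
∑-split (suc m) k f =
  trans (cong (ℤ._+_ (f 0)) (∑-split m k (f ∘ suc))) (sym (ℤ.+-assoc (f 0) _ _))

-- Division with remainder: a number below B * B′ is x + B * y for exactly one low digit x and high
-- digit y. The range is cut into B′ blocks of length B, one for each y, and the two sums are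
-- exchanged.
∑-digits : ∀ B B′ (f : ℕ → ℤ) →
           sumℤ {B * B′} (f ∘ toℕ) ≡ sumℤ {B} (λ x → sumℤ {B′} (λ y → f (toℕ x + B * toℕ y)))
∑-digits B B′ f = begin
  sumℤ {B * B′} (f ∘ toℕ)
    ≡⟨ cong (λ k → sumℤ {k} (f ∘ toℕ)) (ℕ.*-comm B B′) ⟩
  sumℤ {B′ * B} (f ∘ toℕ)
    ≡⟨ blocks B′ f ⟩
  sumℤ {B′} (λ y → sumℤ {B} (λ x → f (toℕ x + B * toℕ y)))
    ≡⟨ ∑-comm {B′} {B} _ ⟩
  sumℤ {B} (λ x → sumℤ {B′} (λ y → f (toℕ x + B * toℕ y))) ∎
  where
  shift : ∀ B x y → B + (x + B * y) ≡ x + B * suc y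
  shift = solve-∀ℕ
  first : ∀ B x → x ≡ x + B * 0
  first = solve-∀ℕ
  blocks : ∀ k (f : ℕ → ℤ) →
           sumℤ {k * B} (f ∘ toℕ) ≡ sumℤ {k} (λ y → sumℤ {B} (λ x → f (toℕ x + B * toℕ y)))
  blocks zero    f = refl
  blocks (suc k) f = trans (∑-split B (k * B) f) (cong₂ ℤ._+_
    (sum-cong-≗ {B} (λ x → cong f (first B (toℕ x))))
    (trans (blocks k (f ∘ _+_ B))
           (sum-cong-≗ {k} (λ y → sum-cong-≗ {B} (λ x → cong f (shift B (toℕ x) (toℕ y)))))))

-- Sums over boxes

boxSum : ℕ → ℕ → (ℕ → ℤ) → ℤ
boxSum zero    B f = f 0
boxSum (suc n) B f = sumℤ {B} (λ d → boxSum n B (λ s → f (toℕ d + s)))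

boxSum-cong : ∀ n B {f g : ℕ → ℤ} → f ≗ g → boxSum n B f ≡ boxSum n B g
boxSum-cong zero    B f≗g = f≗g 0
boxSum-cong (suc n) B f≗g = sum-cong-≗ {B} (λ d → boxSum-cong n B (λ s → f≗g (toℕ d + s)))

boxSum-∑ : ∀ n B {k} (f : Fin k → ℕ → ℤ) →
           sumℤ (λ y → boxSum n B (f y)) ≡ boxSum n B (λ s → sumℤ (λ y → f y s))
boxSum-∑ zero    B f = refl
boxSum-∑ (suc n) B {k} f =
  trans (∑-comm {k} {B} _) (sum-cong-≗ {B} (λ d → boxSum-∑ n B (λ y s → f y (toℕ d + s))))

boxSum-minus : ∀ n B (f g : ℕ → ℤ) →
               boxSum n B (λ s → f s ℤ.- g s) ≡ boxSum n B f ℤ.- boxSum n B g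
boxSum-minus zero    B f g = refl
boxSum-minus (suc n) B f g =
  trans (sum-cong-≗ {B} (λ d → boxSum-minus n B (f ∘ _+_ (toℕ d)) (g ∘ _+_ (toℕ d))))
        (∑-distrib-minus {B} _ _)

boxSum-1 : ∀ n (f : ℕ → ℤ) → boxSum n 1 f ≡ f 0
boxSum-1 zero    f = refl
boxSum-1 (suc n) f = trans (ℤ.+-identityʳ _) (boxSum-1 n f)

-- With every coordinate written as x + B * y, the coordinate sum is the sum of the low digits plus
-- B times the sum of the high digits.
boxSum-digits : ∀ n B B′ (f : ℕ → ℤ) →
                boxSum n (B * B′) f ≡ boxSum n B (λ s → boxSum n B′ (λ t → f (s + B * t)))
boxSum-digits zero    B B′ f = cong f (sym (ℕ.*-zeroʳ B))
boxSum-digits (suc n) B B′ f = begin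
  sumℤ {B * B′} (λ d → boxSum n (B * B′) (λ s → f (toℕ d + s)))
    ≡⟨ sum-cong-≗ {B * B′} (λ d → boxSum-digits n B B′ (f ∘ _+_ (toℕ d))) ⟩
  sumℤ {B * B′} (λ d → boxSum n B (λ s → boxSum n B′ (λ t → f (toℕ d + (s + B * t)))))
    ≡⟨ ∑-digits B B′ (λ d → boxSum n B (λ s → boxSum n B′ (λ t → f (d + (s + B * t))))) ⟩
  sumℤ {B} (λ x → sumℤ {B′} (λ y → boxSum n B (λ s → boxSum n B′ (λ t →
    f (toℕ x + B * toℕ y + (s + B * t))))))
    -- The high digit y of the first coordinate is moved past the box of the remaining low digits,
    -- to join the remaining high digits.
    ≡⟨ sum-cong-≗ {B} (λ x → boxSum-∑ n B {B′} _) ⟩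
  sumℤ {B} (λ x → boxSum n B (λ s → sumℤ {B′} (λ y → boxSum n B′ (λ t →
    f (toℕ x + B * toℕ y + (s + B * t))))))
    ≡⟨ sum-cong-≗ {B} (λ x → boxSum-cong n B (λ s → sum-cong-≗ {B′} (λ y →
         boxSum-cong n B′ (λ t → cong f (regroup B (toℕ x) (toℕ y) s t))))) ⟩
  sumℤ {B} (λ x → boxSum n B (λ s → sumℤ {B′} (λ y → boxSum n B′ (λ t →
    f (toℕ x + s + B * (toℕ y + t)))))) ∎
  where
  regroup : ∀ B x y s t → x + B * y + (s + B * t) ≡ x + s + B * (y + t)
  regroup = solve-∀ℕ

-- Finite differences

-- The operator (1 - T)^N, where T is translation by B.
Δ^ : ℕ → ℕ → (ℤ → ℤ) → ℤ → ℤ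
Δ^ zero    B f m = f m
Δ^ (suc N) B f m = Δ^ N B f m ℤ.- Δ^ N B f (m ℤ.- + B)

∑-telescope : ∀ B (f : ℤ → ℤ) m →
              sumℤ {B} (λ d → Δ^ 1 1 f (m ℤ.- + toℕ d)) ≡ f m ℤ.- f (m ℤ.- + B)
∑-telescope zero    f m = sym (trans (cong (λ x → f m ℤ.- f x) (ℤ.+-identityʳ m)) (ℤ.+-inverseʳ (f m)))
∑-telescope (suc B) f m = begin
  (f (m ℤ.- + 0) ℤ.- f (m ℤ.- + 0 ℤ.- + 1)) ℤ.+ sumℤ {B} (λ d → Δ^ 1 1 f (m ℤ.- + suc (toℕ d)))
    ≡⟨ cong₂ (λ x y → (f x ℤ.- f (x ℤ.- + 1)) ℤ.+ y) (ℤ.+-identityʳ m)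
         (trans (sum-cong-≗ {B} (λ d → cong (Δ^ 1 1 f) (sub-suc (toℕ d)))) (∑-telescope B f (m ℤ.- + 1))) ⟩
  (f m ℤ.- f (m ℤ.- + 1)) ℤ.+ (f (m ℤ.- + 1) ℤ.- f (m ℤ.- + 1 ℤ.- + B))
    ≡⟨ cancel (f m) (f (m ℤ.- + 1)) _ ⟩
  f m ℤ.- f (m ℤ.- + 1 ℤ.- + B)
    ≡⟨ cong (λ x → f m ℤ.- f x) (sub-suc B) ⟨
  f m ℤ.- f (m ℤ.- + suc B) ∎
  where
  cancel : ∀ a b c → (a ℤ.- b) ℤ.+ (b ℤ.- c) ≡ a ℤ.- c
  cancel = solve-∀
  assoc : ∀ m d → m ℤ.- (+ 1 ℤ.+ d) ≡ m ℤ.- + 1 ℤ.- d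
  assoc = solve-∀
  sub-suc : ∀ d → m ℤ.- + suc d ≡ m ℤ.- + 1 ℤ.- + d
  sub-suc d = assoc m (+ d)

-- The n-th power of (1 - T)(1 + T + ... + T^(B-1)) = 1 - T^B, with T the unit translation: each
-- coordinate of the box turns one unit difference into one difference of step B.
boxSum-Δ^ : ∀ n B (f : ℤ → ℤ) m → boxSum n B (λ s → Δ^ n 1 f (m ℤ.- + s)) ≡ Δ^ n B f m
boxSum-Δ^ zero    B f m = cong f (ℤ.+-identityʳ m)
boxSum-Δ^ (suc n) B f m = begin
  sumℤ {B} (λ d → boxSum n B (λ s → Δ^ (suc n) 1 f (m ℤ.- + (toℕ d + s))))
    ≡⟨ boxSum-∑ n B {B} _ ⟩
  boxSum n B (λ s → sumℤ {B} (λ d → Δ^ (suc n) 1 f (m ℤ.- + (toℕ d + s))))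
    ≡⟨ boxSum-cong n B (λ s → sum-cong-≗ {B} (λ d → cong (Δ^ (suc n) 1 f) (sub-+ (toℕ d) s))) ⟩
  boxSum n B (λ s → sumℤ {B} (λ d → Δ^ (suc n) 1 f (m ℤ.- + s ℤ.- + toℕ d)))
    ≡⟨ boxSum-cong n B (λ s → trans (∑-telescope B (Δ^ n 1 f) (m ℤ.- + s))
         (cong (λ x → Δ^ n 1 f (m ℤ.- + s) ℤ.- Δ^ n 1 f x) (swap m (+ s) (+ B)))) ⟩
  boxSum n B (λ s → Δ^ n 1 f (m ℤ.- + s) ℤ.- Δ^ n 1 f (m ℤ.- + B ℤ.- + s))
    ≡⟨ boxSum-minus n B _ _ ⟩
  boxSum n B (λ s → Δ^ n 1 f (m ℤ.- + s)) ℤ.- boxSum n B (λ s → Δ^ n 1 f (m ℤ.- + B ℤ.- + s))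
    ≡⟨ cong₂ ℤ._-_ (boxSum-Δ^ n B f m) (boxSum-Δ^ n B f (m ℤ.- + B)) ⟩
  Δ^ (suc n) B f m ∎
  where
  swap : ∀ m s b → m ℤ.- s ℤ.- b ≡ m ℤ.- b ℤ.- s
  swap = solve-∀
  assoc : ∀ m d s → m ℤ.- (d ℤ.+ s) ≡ m ℤ.- s ℤ.- d
  assoc = solve-∀
  sub-+ : ∀ d s → m ℤ.- + (d + s) ≡ m ℤ.- + s ℤ.- + d
  sub-+ d s = trans (cong (ℤ._-_ m) (ℤ.pos-+ d s)) (assoc m (+ d) (+ s))

-- Binomial expansion of iterated differences

signedC : ℕ → ℕ → ℤ
signedC N l = -1ℤ ℤ.^ l ℤ.* + (N C l)

-- `signedC N l` is the coefficient of x^l in (1 - x)^N, and (1 - x)^(N+1) = (1 - x)^N - x (1 -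
-- x)^N.
signedC-pascal : ∀ N l → signedC (suc N) (suc l) ≡ signedC N (suc l) ℤ.- signedC N l
signedC-pascal N l = begin
  -1ℤ ℤ.* -1ℤ ℤ.^ l ℤ.* + (suc N C suc l)
    ≡⟨ cong (λ c → -1ℤ ℤ.* -1ℤ ℤ.^ l ℤ.* + c) (nCk+nC[k+1]≡[n+1]C[k+1] N l) ⟨
  -1ℤ ℤ.* -1ℤ ℤ.^ l ℤ.* + (N C l + N C suc l)
    ≡⟨ cong (ℤ._*_ (-1ℤ ℤ.* -1ℤ ℤ.^ l)) (ℤ.pos-+ (N C l) _) ⟩
  -1ℤ ℤ.* -1ℤ ℤ.^ l ℤ.* (+ (N C l) ℤ.+ + (N C suc l))
    ≡⟨ expand (-1ℤ ℤ.^ l) (+ (N C l)) (+ (N C suc l)) ⟩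
  signedC N (suc l) ℤ.- signedC N l ∎
  where
  expand : ∀ e a b → -1ℤ ℤ.* e ℤ.* (a ℤ.+ b) ≡ -1ℤ ℤ.* e ℤ.* b ℤ.- e ℤ.* a
  expand = solve-∀

∑-signedC : ∀ N (g : ℕ → ℤ) →
  sumℤ {suc (suc N)} (λ l → signedC (suc N) (toℕ l) ℤ.* g (toℕ l))
    ≡ sumℤ {suc N} (λ l → signedC N (toℕ l) ℤ.* g (toℕ l))
      ℤ.- sumℤ {suc N} (λ l → signedC N (toℕ l) ℤ.* g (suc (toℕ l)))
∑-signedC N g = begin
  first ℤ.+ sumℤ {suc N} (λ l → signedC (suc N) (suc (toℕ l)) ℤ.* g (suc (toℕ l)))
    ≡⟨ cong (ℤ._+_ first) (trans
         (sum-cong-≗ {suc N} (λ l → trans (cong (ℤ._* g (suc (toℕ l))) (signedC-pascal N (toℕ l)))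
                                          (distrib (signedC N (suc (toℕ l))) _ _)))
         (∑-distrib-minus {suc N} (λ l → term (suc (toℕ l))) (λ l → signedC N (toℕ l) ℤ.* g (suc (toℕ l))))) ⟩
  first ℤ.+ (sumℤ {suc N} (λ l → term (suc (toℕ l))) ℤ.- shifted)
    -- `first` also serves as the term l = 0 for N, because both binomial coefficients over 0
    -- compute to the same value.
    ≡⟨ ℤ.+-assoc first _ _ ⟨
  sumℤ {suc (suc N)} (λ l → term (toℕ l)) ℤ.- shifted
    -- The top term l = N+1 is split off; it vanishes because N C (N+1) = 0.
    ≡⟨ cong (ℤ._- shifted) (sum-init-last {suc N} (term ∘ toℕ)) ⟩
  sumℤ {suc N} (λ l → term (toℕ (Fin.inject₁ l))) ℤ.+ term (toℕ (Fin.fromℕ (suc N))) ℤ.- shifted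
    ≡⟨ cong (ℤ._- shifted) (cong₂ ℤ._+_
         (sum-cong-≗ {suc N} (λ l → cong term (toℕ-inject₁ l)))
         (trans (cong term (toℕ-fromℕ (suc N))) last≡0)) ⟩
  sumℤ {suc N} (term ∘ toℕ) ℤ.+ 0ℤ ℤ.- shifted
    ≡⟨ cong (ℤ._- shifted) (ℤ.+-identityʳ (sumℤ {suc N} (term ∘ toℕ))) ⟩
  sumℤ {suc N} (term ∘ toℕ) ℤ.- shifted ∎
  where
  term : ℕ → ℤ
  term l = signedC N l ℤ.* g l
  first shifted : ℤ
  first = signedC (suc N) 0 ℤ.* g 0
  shifted = sumℤ {suc N} (λ l → signedC N (toℕ l) ℤ.* g (suc (toℕ l)))
  distrib : ∀ a b c → (a ℤ.- b) ℤ.* c ≡ a ℤ.* c ℤ.- b ℤ.* c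
  distrib = solve-∀
  last≡0 : term (suc N) ≡ 0ℤ
  last≡0 = begin
    -1ℤ ℤ.^ suc N ℤ.* + (N C suc N) ℤ.* g (suc N)
      ≡⟨ cong (λ c → -1ℤ ℤ.^ suc N ℤ.* + c ℤ.* g (suc N)) (k>n⇒nCk≡0 (ℕ.n<1+n N)) ⟩
    -1ℤ ℤ.^ suc N ℤ.* 0ℤ ℤ.* g (suc N)
      ≡⟨ cong (ℤ._* g (suc N)) (ℤ.*-zeroʳ (-1ℤ ℤ.^ suc N)) ⟩
    0ℤ ℤ.* g (suc N)
      ≡⟨ ℤ.*-zeroˡ (g (suc N)) ⟩
    0ℤ ∎

-- The binomial theorem for (1 - T)^N with T the translation by B.
Δ^-expand : ∀ N B (f : ℤ → ℤ) m →
            Δ^ N B f m ≡ sumℤ {suc N} (λ l → signedC N (toℕ l) ℤ.* f (m ℤ.- + toℕ l ℤ.* + B))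
Δ^-expand zero    B f m =
  trans (cong f (base m (+ B))) (sym (trans (ℤ.+-identityʳ _) (ℤ.*-identityˡ _)))
  where
  base : ∀ m b → m ≡ m ℤ.- + 0 ℤ.* b
  base = solve-∀
Δ^-expand (suc N) B f m = begin
  Δ^ N B f m ℤ.- Δ^ N B f (m ℤ.- + B)
    ≡⟨ cong₂ ℤ._-_ (Δ^-expand N B f m) (trans (Δ^-expand N B f (m ℤ.- + B))
         (sum-cong-≗ {suc N} (λ l → cong (λ x → signedC N (toℕ l) ℤ.* f x) (shift m (+ toℕ l) (+ B))))) ⟩
  sumℤ {suc N} (λ l → signedC N (toℕ l) ℤ.* f (m ℤ.- + toℕ l ℤ.* + B))
    ℤ.- sumℤ {suc N} (λ l → signedC N (toℕ l) ℤ.* f (m ℤ.- + suc (toℕ l) ℤ.* + B))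
    ≡⟨ ∑-signedC N (λ l → f (m ℤ.- + l ℤ.* + B)) ⟨
  sumℤ {suc (suc N)} (λ l → signedC (suc N) (toℕ l) ℤ.* f (m ℤ.- + toℕ l ℤ.* + B)) ∎
  where
  shift : ∀ m l b → m ℤ.- b ℤ.- l ℤ.* b ≡ m ℤ.- (+ 1 ℤ.+ l) ℤ.* b
  shift = solve-∀

-- The number of ways to write m as an ordered sum of n+1 naturals; multisets 0 is the
-- indicator function of m ≥ 0.
multisets : ℕ → ℤ → ℤ
multisets n m = + binom (+ n ℤ.+ m) n

binom-pascal : ∀ k n → + binom (+ 1 ℤ.+ k) (suc n) ℤ.- + binom k (suc n) ≡ + binom k n
binom-pascal (+ a)        n = begin
  + (suc a C suc n) ℤ.- + (a C suc n)
    ≡⟨ cong (λ c → + c ℤ.- + (a C suc n)) (nCk+nC[k+1]≡[n+1]C[k+1] a n) ⟨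
  + (a C n + a C suc n) ℤ.- + (a C suc n)
    ≡⟨ cong (ℤ._- + (a C suc n)) (ℤ.pos-+ (a C n) _) ⟩
  + (a C n) ℤ.+ + (a C suc n) ℤ.- + (a C suc n)
    ≡⟨ cancel (+ (a C n)) (+ (a C suc n)) ⟩
  + (a C n) ∎
  where
  cancel : ∀ x y → x ℤ.+ y ℤ.- y ≡ x
  cancel = solve-∀
-- Here k = -1 and the raised upper index is 0: Pascal's rule survives the crossing because 0 C
-- (n+1) = 0 agrees with the value 0 at negative upper indices.
binom-pascal -[1+ zero  ] n = refl
binom-pascal -[1+ suc a ] n = refl

Δ-multisets : ∀ n m → Δ^ 1 1 (multisets (suc n)) m ≡ multisets n m
Δ-multisets n m = begin
  + binom (+ suc n ℤ.+ m) (suc n) ℤ.- + binom (+ suc n ℤ.+ (m ℤ.- + 1)) (suc n)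
    ≡⟨ cong₂ (λ x y → + binom x (suc n) ℤ.- + binom y (suc n)) (upper (+ n) m) (lower (+ n) m) ⟩
  + binom (+ 1 ℤ.+ (+ n ℤ.+ m)) (suc n) ℤ.- + binom (+ n ℤ.+ m) (suc n)
    ≡⟨ binom-pascal (+ n ℤ.+ m) n ⟩
  + binom (+ n ℤ.+ m) n ∎
  where
  upper : ∀ n m → (+ 1 ℤ.+ n) ℤ.+ m ≡ + 1 ℤ.+ (n ℤ.+ m)
  upper = solve-∀
  lower : ∀ n m → (+ 1 ℤ.+ n) ℤ.+ (m ℤ.- + 1) ≡ n ℤ.+ m
  lower = solve-∀

Δ^-multisets : ∀ k n m → Δ^ k 1 (multisets (k + n)) m ≡ multisets n m
Δ^-multisets zero    n m = refl
Δ^-multisets (suc k) n m = begin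
  Δ^ (suc k) 1 (multisets (suc k + n)) m
    -- Moving the successor onto n lets the induction hypothesis remove k differences, leaving a
    -- single one.
    ≡⟨ cong (λ N → Δ^ (suc k) 1 (multisets N) m) (ℕ.+-suc k n) ⟨
  Δ^ (suc k) 1 (multisets (k + suc n)) m
    ≡⟨ cong₂ ℤ._-_ (Δ^-multisets k (suc n) m) (Δ^-multisets k (suc n) (m ℤ.- + 1)) ⟩
  Δ^ 1 1 (multisets (suc n)) m
    ≡⟨ Δ-multisets n m ⟩
  multisets n m ∎

-- The left side counts the points of the box with coordinate sum at most m. Its summand is the
-- n-fold unit difference of `multisets n`, so telescoping applies.
boxSum-multisets : ∀ n B m → boxSum n B (λ s → multisets 0 (m ℤ.- + s)) ≡ Δ^ n B (multisets n) m
boxSum-multisets n B m = begin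
  boxSum n B (λ s → multisets 0 (m ℤ.- + s))
    ≡⟨ boxSum-cong n B (λ s → trans
         (cong (λ N → Δ^ n 1 (multisets N) (m ℤ.- + s)) (sym (ℕ.+-identityʳ n)))
         (Δ^-multisets n 0 (m ℤ.- + s))) ⟨
  boxSum n B (λ s → Δ^ n 1 (multisets n) (m ℤ.- + s))
    ≡⟨ boxSum-Δ^ n B (multisets n) m ⟩
  Δ^ n B (multisets n) m ∎

-- The Kronecker delta at 0.
δ : ℤ → ℤ
δ = Δ^ 1 1 (multisets 0)

δ-nonzero : ∀ x → x ≢ 0ℤ → δ x ≡ 0ℤ
δ-nonzero (+ zero)  x≢0 = contradiction refl x≢0
δ-nonzero (+ suc a) x≢0 = refl
δ-nonzero -[1+ a ]  x≢0 = refl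

-- A remainder does not change the sign of the quotient. Writing the modulus as `suc (ρ + e)` builds
-- in that ρ is smaller than it.
multisets₀-floor : ∀ k ρ e → multisets 0 (k ℤ.* + suc (ρ + e) ℤ.+ + ρ) ≡ multisets 0 k
multisets₀-floor (+ a) ρ e =
  cong (λ x → multisets 0 (x ℤ.+ + ρ)) (sym (ℤ.pos-* a (suc (ρ + e))))
-- For negative k the number is brought to the form `-[1+ _ ]`, on which `binom` computes to 0.
multisets₀-floor -[1+ a ] ρ e = cong (multisets 0) (begin
  -[1+ a ] ℤ.* + suc (ρ + e) ℤ.+ + ρ
    ≡⟨ cong (λ x → -[1+ a ] ℤ.* (+ 1 ℤ.+ x) ℤ.+ + ρ) (ℤ.pos-+ ρ e) ⟩
  ℤ.- (+ 1 ℤ.+ + a) ℤ.* (+ 1 ℤ.+ (+ ρ ℤ.+ + e)) ℤ.+ + ρ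
    ≡⟨ negative (+ a) (+ ρ) (+ e) ⟩
  ℤ.- (+ 1 ℤ.+ (+ e ℤ.+ + a ℤ.* (+ 1 ℤ.+ (+ ρ ℤ.+ + e))))
    ≡⟨ cong (λ x → ℤ.- (+ 1 ℤ.+ (+ e ℤ.+ x))) (ℤ.pos-* a (suc (ρ + e))) ⟨
  -[1+ e + a * suc (ρ + e) ] ∎)
  where
  negative : ∀ a ρ e → ℤ.- (+ 1 ℤ.+ a) ℤ.* (+ 1 ℤ.+ (ρ ℤ.+ e)) ℤ.+ ρ
                     ≡ ℤ.- (+ 1 ℤ.+ (e ℤ.+ a ℤ.* (+ 1 ℤ.+ (ρ ℤ.+ e))))
  negative = solve-∀


-- With B = 2c+1 and q = ⌊t/B⌋, jB + 2c - t = (j-q)B + e with 0 ≤ e < B, so it is nonnegative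
-- exactly when j - q is.
quotient-indicator : ∀ c j t →
  δ (+ j ℤ.- + (t / suc (2 * c)))
    ≡ multisets 0 (+ j ℤ.* + suc (2 * c) ℤ.+ + (2 * c) ℤ.- + t)
      ℤ.- multisets 0 (+ j ℤ.* + suc (2 * c) ℤ.+ + (2 * c) ℤ.- + t ℤ.- + suc (2 * c))
quotient-indicator c j t = sym (cong₂ ℤ._-_
  (trans (cong (multisets 0) m≡) (floor (+ j ℤ.- + q)))
  (trans (cong (multisets 0) m-B≡) (floor (+ j ℤ.- + q ℤ.- + 1))))
  where
  B q ρ e : ℕ
  B = suc (2 * c)
  q = t / B
  ρ = t % B
  e = 2 * c ∸ ρ
  e+ρ≡2c : e + ρ ≡ 2 * c
  e+ρ≡2c = ℕ.m∸n+n≡m (ℕ.≤-pred (m%n<n t B))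
  floor : ∀ k → multisets 0 (k ℤ.* + B ℤ.+ + e) ≡ multisets 0 k
  floor k = trans (cong (λ x → multisets 0 (k ℤ.* + suc x ℤ.+ + e)) (sym e+ρ≡2c))
                  (multisets₀-floor k e ρ)
  t≡ : + t ≡ + ρ ℤ.+ + q ℤ.* + B
  t≡ = trans (cong +_ (m≡m%n+[m/n]*n t B))
             (trans (ℤ.pos-+ ρ (q * B)) (cong (ℤ._+_ (+ ρ)) (ℤ.pos-* q B)))
  regroup : ∀ j b e ρ q → j ℤ.* b ℤ.+ (e ℤ.+ ρ) ℤ.- (ρ ℤ.+ q ℤ.* b) ≡ (j ℤ.- q) ℤ.* b ℤ.+ e
  regroup = solve-∀
  m≡ : + j ℤ.* + B ℤ.+ + (2 * c) ℤ.- + t ≡ (+ j ℤ.- + q) ℤ.* + B ℤ.+ + e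
  m≡ = trans (cong₂ (λ x y → + j ℤ.* + B ℤ.+ x ℤ.- y)
                    (trans (cong +_ (sym e+ρ≡2c)) (ℤ.pos-+ e ρ)) t≡)
             (regroup (+ j) (+ B) (+ e) (+ ρ) (+ q))
  lower : ∀ k b e → k ℤ.* b ℤ.+ e ℤ.- b ≡ (k ℤ.- + 1) ℤ.* b ℤ.+ e
  lower = solve-∀
  m-B≡ : + j ℤ.* + B ℤ.+ + (2 * c) ℤ.- + t ℤ.- + B ≡ (+ j ℤ.- + q ℤ.- + 1) ℤ.* + B ℤ.+ + e
  m-B≡ = trans (cong (ℤ._- + B) m≡) (lower (+ j ℤ.- + q) (+ B) (+ e))

-- Carries in an arbitrary base

-- The unnormalised transition operator: B^n times the expected value of g at the next carry from i,
-- when the constant addend has digit c. States are plain naturals, so no bound on carries has to be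
-- transported.
carrySum : ∀ n B .{{_ : NonZero B}} → ℕ → (ℕ → ℤ) → ℕ → ℤ
carrySum n B c g i = boxSum n B (λ s → g ((i + c + s) / B))

-- The base is a variable with an equation, so that the result applies both to 2b+1 and to its
-- powers.
carrySum-δ : ∀ n {B} .{{_ : NonZero B}} c i j → B ≡ suc (2 * c) →
  carrySum n B c (λ k → δ (+ j ℤ.- + k)) i ≡ alternatingSum n B c i j
carrySum-δ n {B} c i j refl = begin
  boxSum n B (λ s → δ (+ j ℤ.- + ((i + c + s) / B)))
    ≡⟨ boxSum-cong n B (λ s → trans (quotient-indicator c j (i + c + s))
         (cong₂ (λ x y → multisets 0 x ℤ.- multisets 0 y) (position s)
           (trans (cong (ℤ._- + B) (position s)) (swap m (+ s) (+ B))))) ⟩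
  boxSum n B (λ s → multisets 0 (m ℤ.- + s) ℤ.- multisets 0 (m ℤ.- + B ℤ.- + s))
    ≡⟨ boxSum-minus n B _ _ ⟩
  boxSum n B (λ s → multisets 0 (m ℤ.- + s)) ℤ.- boxSum n B (λ s → multisets 0 (m ℤ.- + B ℤ.- + s))
    -- The n coordinates give n differences and the floor indicator gives one more, whence n+1 in
    -- the binomial coefficients.
    ≡⟨ cong₂ ℤ._-_ (boxSum-multisets n B m) (boxSum-multisets n B (m ℤ.- + B)) ⟩
  Δ^ (suc n) B (multisets n) m
    ≡⟨ Δ^-expand (suc n) B (multisets n) m ⟩
  sumℤ {suc (suc n)} (λ l → signedC (suc n) (toℕ l) ℤ.* multisets n (m ℤ.- + toℕ l ℤ.* + B))
    ≡⟨ sum-cong-≗ {suc (suc n)} (λ l → cong (λ x → signedC (suc n) (toℕ l) ℤ.* + binom x n)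
         (index (+ n) (+ j) (+ toℕ l) (+ B) (+ c) (+ i))) ⟩
  alternatingSum n B c i j ∎
  where
  m : ℤ
  m = + j ℤ.* + B ℤ.+ + c ℤ.- + i
  swap : ∀ m s b → m ℤ.- s ℤ.- b ≡ m ℤ.- b ℤ.- s
  swap = solve-∀
  index : ∀ n j l b c i → n ℤ.+ (j ℤ.* b ℤ.+ c ℤ.- i ℤ.- l ℤ.* b)
                        ≡ n ℤ.+ (j ℤ.- l) ℤ.* b ℤ.+ c ℤ.- i
  index = solve-∀
  regroup : ∀ x c i s → x ℤ.+ + 2 ℤ.* c ℤ.- (i ℤ.+ c ℤ.+ s) ≡ x ℤ.+ c ℤ.- i ℤ.- s
  regroup = solve-∀
  position : ∀ s → + j ℤ.* + B ℤ.+ + (2 * c) ℤ.- + (i + c + s) ≡ m ℤ.- + s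
  position s = trans
    (cong₂ (λ x y → + j ℤ.* + B ℤ.+ x ℤ.- y) (ℤ.pos-* 2 c)
      (trans (ℤ.pos-+ (i + c) s) (cong (ℤ._+ + s) (ℤ.pos-+ i c))))
    (regroup (+ j ℤ.* + B) (+ c) (+ i) (+ s))

-- In base 1 the only digit is 0 and the carry never changes; this is the case of zero steps.
carrySum-1 : ∀ n g i → carrySum n 1 0 g i ≡ g i
carrySum-1 n g i = trans (boxSum-1 n _)
  (cong g (trans (n/1≡n _) (trans (ℕ.+-identityʳ _) (ℕ.+-identityʳ i))))

-- The first step reads the low digits and the second the high ones, so the constant addend becomes
-- c + B * c′. Multiples of B leave the inner floor, and the two nested floors become one division
-- by B * B′.
carrySum-∘ : ∀ n B B′ .{{_ : NonZero B}} .{{_ : NonZero B′}} .{{_ : NonZero (B * B′)}} c c′ g i →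
  carrySum n B c (carrySum n B′ c′ g) i ≡ carrySum n (B * B′) (c + B * c′) g i
carrySum-∘ n B B′ c c′ g i = sym (trans (boxSum-digits n B B′ _)
  (boxSum-cong n B (λ s → boxSum-cong n B′ (λ t → cong g (quotient s t)))))
  where
  regroup : ∀ i c B c′ s t → i + (c + B * c′) + (s + B * t) ≡ i + c + s + (c′ + t) * B
  regroup = solve-∀ℕ
  quotient : ∀ s t → (i + (c + B * c′) + (s + B * t)) / (B * B′) ≡ ((i + c + s) / B + c′ + t) / B′
  quotient s t = begin
    (i + (c + B * c′) + (s + B * t)) / (B * B′)
      ≡⟨ /-congˡ {B * B′} (regroup i c B c′ s t) ⟩
    (i + c + s + (c′ + t) * B) / (B * B′)
      ≡⟨ m/n/o≡m/[n*o] (i + c + s + (c′ + t) * B) B B′ ⟨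
    (i + c + s + (c′ + t) * B) / B / B′
      ≡⟨ /-congˡ {B′} (+-distrib-/-∣ʳ (i + c + s) (divides (c′ + t) refl)) ⟩
    ((i + c + s) / B + (c′ + t) * B / B) / B′
      ≡⟨ /-congˡ {B′} (cong (_+_ ((i + c + s) / B)) (m*n/n≡m (c′ + t) B)) ⟩
    ((i + c + s) / B + (c′ + t)) / B′
      ≡⟨ /-congˡ {B′} (ℕ.+-assoc ((i + c + s) / B) c′ t) ⟨
    ((i + c + s) / B + c′ + t) / B′ ∎

-- Counting columns

χ : Fin n → Fin n → ℤ
χ k j = if does (k Fin.≟ j) then 1ℤ else 0ℤ

-- Replaces decidable equality of states by an integer function to which differences apply.
χ≡δ : ∀ (k j : Fin n) → χ k j ≡ δ (+ toℕ j ℤ.- + toℕ k)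
χ≡δ k j with k Fin.≟ j
... | yes refl = cong δ (sym (ℤ.+-inverseʳ (+ toℕ k)))
... | no k≢j = sym (δ-nonzero _ (λ eq →
  k≢j (sym (toℕ-injective (ℤ.+-injective (ℤ.i-j≡0⇒i≡j (+ toℕ j) (+ toℕ k) eq))))))

∑-χ : ∀ (k : Fin n) (g : Fin n → ℤ) → sumℤ (λ j → χ k j ℤ.* g j) ≡ g k
∑-χ {suc n} zero g = begin
  1ℤ ℤ.* g zero ℤ.+ sumℤ {n} (λ j → 0ℤ ℤ.* g (suc j))
    ≡⟨ cong₂ ℤ._+_ (ℤ.*-identityˡ (g zero)) (trans (sum-cong-≗ {n} (λ j → ℤ.*-zeroˡ (g (suc j))))
                                                   (sum-replicate-zero n)) ⟩
  g zero ℤ.+ 0ℤ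
    ≡⟨ ℤ.+-identityʳ (g zero) ⟩
  g zero ∎
∑-χ (suc k) g = trans (cong₂ ℤ._+_ (ℤ.*-zeroˡ (g zero)) (∑-χ k (g ∘ suc))) (ℤ.+-identityˡ _)

-- Sums over lists and over the sample space

∑ₗ : (A → ℤ) → List A → ℤ
∑ₗ f []       = 0ℤ
∑ₗ f (x ∷ xs) = f x ℤ.+ ∑ₗ f xs

∑ₗ-cong : ∀ {f g : A → ℤ} → f ≗ g → ∀ xs → ∑ₗ f xs ≡ ∑ₗ g xs
∑ₗ-cong f≗g []       = refl
∑ₗ-cong f≗g (x ∷ xs) = cong₂ ℤ._+_ (f≗g x) (∑ₗ-cong f≗g xs)

∑ₗ-++ : ∀ (f : A → ℤ) xs ys → ∑ₗ f (xs ++ ys) ≡ ∑ₗ f xs ℤ.+ ∑ₗ f ys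
∑ₗ-++ f []       ys = sym (ℤ.+-identityˡ _)
∑ₗ-++ f (x ∷ xs) ys = trans (cong (ℤ._+_ (f x)) (∑ₗ-++ f xs ys)) (sym (ℤ.+-assoc (f x) _ _))

∑ₗ-map : ∀ {A B : Set} (f : B → ℤ) (h : A → B) xs → ∑ₗ f (map h xs) ≡ ∑ₗ (f ∘ h) xs
∑ₗ-map f h []       = refl
∑ₗ-map f h (x ∷ xs) = cong (ℤ._+_ (f (h x))) (∑ₗ-map f h xs)

∑ₗ-tabulate : ∀ (f : A → ℤ) (h : Fin n → A) → ∑ₗ f (tabulate h) ≡ sumℤ (f ∘ h)
∑ₗ-tabulate {n = zero}  f h = refl
∑ₗ-tabulate {n = suc n} f h = cong (ℤ._+_ (f (h zero))) (∑ₗ-tabulate f (h ∘ suc))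

∑ₗ-cartesianProductWith : ∀ {A B C : Set} (f : C → ℤ) (h : A → B → C) xs ys →
  ∑ₗ f (cartesianProductWith h xs ys) ≡ ∑ₗ (λ x → ∑ₗ (λ y → f (h x y)) ys) xs
∑ₗ-cartesianProductWith f h []       ys = refl
∑ₗ-cartesianProductWith f h (x ∷ xs) ys =
  trans (∑ₗ-++ f (map (h x) ys) _) (cong₂ ℤ._+_ (∑ₗ-map f (h x) ys) (∑ₗ-cartesianProductWith f h xs ys))

length-filter-∑ₗ : ∀ {P : Pred A 0ℓ} (P? : Decidable P) xs →
  + length (filter P? xs) ≡ ∑ₗ (λ x → if does (P? x) then 1ℤ else 0ℤ) xs
length-filter-∑ₗ P? []       = refl
length-filter-∑ₗ P? (x ∷ xs) with P? x
... | yes _ = cong (ℤ._+_ 1ℤ) (length-filter-∑ₗ P? xs)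
... | no  _ = trans (length-filter-∑ₗ P? xs) (sym (ℤ.+-identityˡ _))

-- The entries are grouped by their image: each x is counted for the single k equal to h x.
∑-fibres : ∀ (h : A → Fin n) (g : Fin n → ℤ) xs →
  sumℤ (λ k → + length (filter (λ x → h x Fin.≟ k) xs) ℤ.* g k) ≡ ∑ₗ (g ∘ h) xs
∑-fibres {n = n} h g xs = trans
  (sum-cong-≗ {n} (λ k → cong (ℤ._* g k) (length-filter-∑ₗ (λ x → h x Fin.≟ k) xs)))
  (exchange xs)
  where
  exchange : ∀ xs → sumℤ (λ k → ∑ₗ (λ x → χ (h x) k) xs ℤ.* g k) ≡ ∑ₗ (g ∘ h) xs
  exchange []       = trans (sum-cong-≗ {n} (λ k → ℤ.*-zeroˡ (g k))) (sum-replicate-zero n)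
  exchange (x ∷ xs) = begin
    sumℤ (λ k → (χ (h x) k ℤ.+ ∑ₗ (λ x → χ (h x) k) xs) ℤ.* g k)
      ≡⟨ sum-cong-≗ {n} (λ k → ℤ.*-distribʳ-+ (g k) (χ (h x) k) _) ⟩
    sumℤ (λ k → χ (h x) k ℤ.* g k ℤ.+ ∑ₗ (λ x → χ (h x) k) xs ℤ.* g k)
      ≡⟨ ∑-distrib-+ {n} _ _ ⟩
    sumℤ (λ k → χ (h x) k ℤ.* g k) ℤ.+ sumℤ (λ k → ∑ₗ (λ x → χ (h x) k) xs ℤ.* g k)
      ≡⟨ cong₂ ℤ._+_ (∑-χ (h x) g) (exchange xs) ⟩
    g (h x) ℤ.+ ∑ₗ (g ∘ h) xs ∎

∑ₗ-columns : ∀ b n (f : ℕ → ℤ) → ∑ₗ (f ∘ digitSum b) (columns b n) ≡ boxSum n (suc (2 * b)) f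
∑ₗ-columns b zero    f = ℤ.+-identityʳ (f 0)
∑ₗ-columns b (suc n) f = begin
  ∑ₗ (f ∘ digitSum b) (columns b (suc n))
    ≡⟨ ∑ₗ-cartesianProductWith (f ∘ digitSum b) Vec._∷_ (allFin (suc (2 * b))) (columns b n) ⟩
  ∑ₗ (λ d → ∑ₗ (λ x → f (toℕ d + digitSum b x)) (columns b n)) (allFin (suc (2 * b)))
    ≡⟨ ∑ₗ-tabulate {n = suc (2 * b)} (λ d → ∑ₗ (λ x → f (toℕ d + digitSum b x)) (columns b n)) id ⟩
  sumℤ {suc (2 * b)} (λ d → ∑ₗ (λ x → f (toℕ d + digitSum b x)) (columns b n))
    ≡⟨ sum-cong-≗ {suc (2 * b)} (λ d → ∑ₗ-columns b n (f ∘ _+_ (toℕ d))) ⟩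
  boxSum (suc n) (suc (2 * b)) f ∎

∑ₗ-nextCarry : ∀ n b i (G : ℕ → ℤ) →
  ∑ₗ (λ x → G (toℕ (nextCarry n b i x))) (columns b n) ≡ carrySum n (suc (2 * b)) b G (toℕ i)
∑ₗ-nextCarry n b i G = trans
  (∑ₗ-cong (λ x → cong G (toℕ-fromℕ< (carry<suc-n n b i x))) (columns b n))
  (∑ₗ-columns b n (λ s → G ((toℕ i + b + s) / suc (2 * b))))

transitionCount : ∀ n b → Fin (suc n) → Fin (suc n) → ℕ
transitionCount n b i j = length (filter (λ x → nextCarry n b i x Fin.≟ j) (columns b n))

transitionCount≡carrySum : ∀ n b i j →
  + transitionCount n b i j ≡ carrySum n (suc (2 * b)) b (λ k → δ (+ toℕ j ℤ.- + k)) (toℕ i)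
transitionCount≡carrySum n b i j = trans
  (length-filter-∑ₗ (λ x → nextCarry n b i x Fin.≟ j) (columns b n)) (trans
  (∑ₗ-cong (λ x → χ≡δ (nextCarry n b i x) j) (columns b n))
  (∑ₗ-nextCarry n b i (λ k → δ (+ toℕ j ℤ.- + k))))

-- A row of the unnormalised transition matrix acts on functions as `carrySum`, which turns matrix
-- products into compositions.
∑-transitionCount : ∀ n b i (G : ℕ → ℤ) →
  sumℤ (λ k → + transitionCount n b i k ℤ.* G (toℕ k)) ≡ carrySum n (suc (2 * b)) b G (toℕ i)
∑-transitionCount n b i G =
  trans (∑-fibres (nextCarry n b i) (G ∘ toℕ) (columns b n)) (∑ₗ-nextCarry n b i G)

-- Fractions with a common denominator

-- Rationals are kept in lowest terms, so the comparison is made between unnormalised fractions,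
-- where the product is already the right-hand fraction.
/-*-/ : ∀ p q d e .{{_ : NonZero d}} .{{_ : NonZero e}} .{{_ : NonZero (d * e)}} →
        (p ℚ./ d) ℚ.* (q ℚ./ e) ≡ (p ℤ.* q) ℚ./ (d * e)
/-*-/ p q d@(suc d-1) e@(suc e-1) = ℚ.toℚᵘ-injective
  (ℚᵘ.≃-trans (ℚ.toℚᵘ-homo-* (p ℚ./ d) (q ℚ./ e))
  (ℚᵘ.≃-trans (ℚᵘ.*-cong (ℚ.toℚᵘ-fromℚᵘ (mkℚᵘ p d-1)) (ℚ.toℚᵘ-fromℚᵘ (mkℚᵘ q e-1)))
  (ℚᵘ.≃-sym (ℚ.toℚᵘ-fromℚᵘ (mkℚᵘ (p ℤ.* q) _)))))

/-+-/ : ∀ p q d .{{_ : NonZero d}} → (p ℚ./ d) ℚ.+ (q ℚ./ d) ≡ (p ℤ.+ q) ℚ./ d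
/-+-/ p q d@(suc d-1) = ℚ.toℚᵘ-injective
  (ℚᵘ.≃-trans (ℚ.toℚᵘ-homo-+ (p ℚ./ d) (q ℚ./ d))
  (ℚᵘ.≃-trans (ℚᵘ.+-cong (ℚ.toℚᵘ-fromℚᵘ (mkℚᵘ p d-1)) (ℚ.toℚᵘ-fromℚᵘ (mkℚᵘ q d-1)))
  (ℚᵘ.≃-trans (*≡* cross) (ℚᵘ.≃-sym (ℚ.toℚᵘ-fromℚᵘ (mkℚᵘ (p ℤ.+ q) d-1))))))
  where
  distrib : ∀ p q d → (p ℤ.* d ℤ.+ q ℤ.* d) ℤ.* d ≡ (p ℤ.+ q) ℤ.* (d ℤ.* d)
  distrib = solve-∀
  cross : (p ℤ.* + d ℤ.+ q ℤ.* + d) ℤ.* + d ≡ (p ℤ.+ q) ℤ.* + (d * d)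
  cross = trans (distrib p q (+ d)) (cong (ℤ._*_ (p ℤ.+ q)) (sym (ℤ.pos-* d d)))

∑-/ : ∀ d .{{_ : NonZero d}} (f : Fin n → ℤ) → sumℚ (λ k → f k ℚ./ d) ≡ sumℤ f ℚ./ d
∑-/ {zero}  d f = sym (ℚ.0/n≡0 d)
∑-/ {suc n} d f = trans (cong (ℚ._+_ (f zero ℚ./ d)) (∑-/ d (f ∘ suc))) (/-+-/ (f zero) _ d)

-- Powers of the chain

-- ((2b+1)^r - 1) / 2, the number whose r base-(2b+1) digits all equal b.
repdigit : ℕ → ℕ → ℕ
repdigit b zero    = 0
repdigit b (suc r) = b + suc (2 * b) * repdigit b r

-- A power of an odd base is odd; this supplies the hypothesis on the base in `carrySum-δ`.
^≡1+2*repdigit : ∀ b r → suc (2 * b) ^ r ≡ suc (2 * repdigit b r)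
^≡1+2*repdigit b zero    = refl
^≡1+2*repdigit b (suc r) = trans (cong (suc (2 * b) *_) (^≡1+2*repdigit b r)) (lemma b (repdigit b r))
  where
  lemma : ∀ b c → suc (2 * b) * suc (2 * c) ≡ suc (2 * (b + suc (2 * b) * c))
  lemma = solve-∀ℕ

-- Truncated subtraction and floor division are both exact here, since the power is 1 plus twice the
-- repdigit.
repdigit≡ : ∀ b r → (suc (2 * b) ^ r ∸ 1) / 2 ≡ repdigit b r
repdigit≡ b r = trans
  (/-congˡ {2} (trans (cong (_∸ 1) (^≡1+2*repdigit b r)) (ℕ.*-comm 2 (repdigit b r))))
  (m*n/n≡m (repdigit b r) 2)

-- Induction on r: a step in front of r steps prepends a least significant digit, so `carrySum-∘`
-- merges base B and base B^r into base B^(r+1), with constant b + B * `repdigit b r`.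
stepMatrix-carrySum : ∀ n b r i j →
  stepMatrix (carriesMatrix n b) r i j
    ≡ carrySum n (suc (2 * b) ^ r) {{m^n≢0 (suc (2 * b)) r}} (repdigit b r)
               (λ k → δ (+ toℕ j ℤ.- + k)) (toℕ i) /[2 b +1]^ (r * n)
stepMatrix-carrySum n b zero    i j = trans (if-χ i j)
  (cong (_/[2 b +1]^ 0) (sym (trans (carrySum-1 n (λ k → δ (+ toℕ j ℤ.- + k)) (toℕ i)) (sym (χ≡δ i j)))))
  where
  if-χ : ∀ i j → (if does (i Fin.≟ j) then 1ℚ else 0ℚ) ≡ χ i j /[2 b +1]^ 0
  if-χ i j with i Fin.≟ j
  ... | yes _ = refl
  ... | no  _ = refl
stepMatrix-carrySum n b (suc r) i j = begin
  sumℚ (λ k → carriesMatrix n b i k ℚ.* stepMatrix (carriesMatrix n b) r k j)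
    -- All summands are put over the common denominator B^(n + r * n), so that the rest is an
    -- identity of integers.
    ≡⟨ ℚ-Sum.sum-cong-≗ {suc n} product ⟩
  sumℚ (λ k → (+ transitionCount n b i k ℤ.* G (toℕ k)) /[2 b +1]^ (n + r * n))
    ≡⟨ ∑-/ (B ^ (n + r * n)) (λ k → + transitionCount n b i k ℤ.* G (toℕ k)) ⟩
  sumℤ (λ k → + transitionCount n b i k ℤ.* G (toℕ k)) /[2 b +1]^ (n + r * n)
    ≡⟨ cong (_/[2 b +1]^ (n + r * n)) (∑-transitionCount n b i G) ⟩
  carrySum n B b G (toℕ i) /[2 b +1]^ (n + r * n)
    ≡⟨ cong (_/[2 b +1]^ (n + r * n))
         (carrySum-∘ n B (B ^ r) b (repdigit b r) (λ k → δ (+ toℕ j ℤ.- + k)) (toℕ i)) ⟩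
  carrySum n (B ^ suc r) (repdigit b (suc r)) (λ k → δ (+ toℕ j ℤ.- + k)) (toℕ i) /[2 b +1]^ (n + r * n) ∎
  where
  B : ℕ
  B = suc (2 * b)
  instance
    B^n≢0 : NonZero (B ^ n)
    B^n≢0 = m^n≢0 B n
    B^r≢0 : NonZero (B ^ r)
    B^r≢0 = m^n≢0 B r
    B^[1+r]≢0 : NonZero (B ^ suc r)
    B^[1+r]≢0 = m^n≢0 B (suc r)
    B^rn≢0 : NonZero (B ^ (r * n))
    B^rn≢0 = m^n≢0 B (r * n)
    B^[n+rn]≢0 : NonZero (B ^ (n + r * n))
    B^[n+rn]≢0 = m^n≢0 B (n + r * n)
    B^n*B^rn≢0 : NonZero (B ^ n * B ^ (r * n))
    B^n*B^rn≢0 = m*n≢0 (B ^ n) (B ^ (r * n))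
  G : ℕ → ℤ
  G = carrySum n (B ^ r) (repdigit b r) (λ k → δ (+ toℕ j ℤ.- + k))
  product : ∀ k → carriesMatrix n b i k ℚ.* stepMatrix (carriesMatrix n b) r k j
                ≡ (+ transitionCount n b i k ℤ.* G (toℕ k)) /[2 b +1]^ (n + r * n)
  product k = begin
    carriesMatrix n b i k ℚ.* stepMatrix (carriesMatrix n b) r k j
      ≡⟨ cong (ℚ._*_ (carriesMatrix n b i k)) (stepMatrix-carrySum n b r k j) ⟩
    (+ transitionCount n b i k /[2 b +1]^ n) ℚ.* (G (toℕ k) /[2 b +1]^ (r * n))
      ≡⟨ /-*-/ (+ transitionCount n b i k) (G (toℕ k)) (B ^ n) (B ^ (r * n)) ⟩
    (+ transitionCount n b i k ℤ.* G (toℕ k)) ℚ./ (B ^ n * B ^ (r * n))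
      ≡⟨ ℚ./-cong {+ transitionCount n b i k ℤ.* G (toℕ k)} refl
           (sym (ℕ.^-distribˡ-+-* B n (r * n))) ⟩
    (+ transitionCount n b i k ℤ.* G (toℕ k)) /[2 b +1]^ (n + r * n) ∎

-- One-step and r-step transition formulas

theorem4p2 : ∀ (n b : ℕ) → n ≥ 1 → b ≥ 1 → ∀ (i j : Fin (suc n)) →
    (carriesMatrix n b i j
    ≡ alternatingSum n (suc (2 * b)) b (toℕ i) (toℕ j) /[2 b +1]^ n)
    × (∀ (r : ℕ) → r ≥ 1 →
    stepMatrix (carriesMatrix n b) r i j
    ≡ alternatingSum n (suc (2 * b) ^ r) ((suc (2 * b) ^ r ∸ 1) / 2) (toℕ i) (toℕ j)
    /[2 b +1]^ (r * n))
theorem4p2 n b _ _ i j = oneStep , manySteps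
  where
  oneStep : carriesMatrix n b i j ≡ alternatingSum n (suc (2 * b)) b (toℕ i) (toℕ j) /[2 b +1]^ n
  oneStep = cong (_/[2 b +1]^ n)
    (trans (transitionCount≡carrySum n b i j) (carrySum-δ n b (toℕ i) (toℕ j) refl))
  manySteps : ∀ r → r ≥ 1 → stepMatrix (carriesMatrix n b) r i j
    ≡ alternatingSum n (suc (2 * b) ^ r) ((suc (2 * b) ^ r ∸ 1) / 2) (toℕ i) (toℕ j)
      /[2 b +1]^ (r * n)
  manySteps r _ = trans (stepMatrix-carrySum n b r i j) (cong (_/[2 b +1]^ (r * n)) (trans
    (carrySum-δ n {{m^n≢0 (suc (2 * b)) r}} (repdigit b r) (toℕ i) (toℕ j) (^≡1+2*repdigit b r))
    (cong (λ c → alternatingSum n (suc (2 * b) ^ r) c (toℕ i) (toℕ j)) (sym (repdigit≡ b r)))))
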